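{- Let $d\ge 1$ and let $k_1,\ldots,k_d$ be positive integers with $k_1\cdot k_2\cdots k_d>1$. Then, as $n\to\infty$, $$f(n,R^{k_1,\ldots,k_d},d)=\Omega\left(n^{d-\beta(k_1,\ldots,k_d)}\right),\qquad\text{where } \beta(k_1,\ldots,k_d)=\frac{k_1+\cdots+k_d-d}{k_1\cdot k_2\cdots k_d-1}.$$
   Context: A $d$-dimensional $n_1\times\cdots\times n_d$ zero-one matrix is an array $A=(a_{i_1,\ldots,i_d})$, $1\le i_\ell\le n_\ell$, with entries in $\{0,1\}$. A submatrix is obtained by selecting, for each $\ell$, a set of values of the $\ell$-th coordinate (keeping the order). $A$ contains a $d$-dimensional zero-one matrix $P$ if some submatrix of $A$ can be transformed into $P$ by changing any number of ones to zeros; otherwise $A$ avoids $P$. $f(n,P,d)$ denotes the maximum number of ones in a $d$-dimensional $n\times\cdots\times n$ zero-one matrix that avoids $P$. $R^{k_1,\ldots,k_d}$ denotes the $d$-dimensional $k_1\times\cdots\times k_d$ matrix of all ones. The implied constant may depend on $d,k_1,\ldots,k_d$ but not on $n$. -}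

module Defs where

open import Data.Bool.Base as Bool using (Bool; true; false; if_then_else_)
import Data.Bool.Properties as Bool
open import Data.Fin.Subset using (Subset; inside; outside; ∣_∣)
open import Data.Fin.Subset.Properties using (anySubset?)
open import Data.Integer.Base as ℤ using (+_; -[1+_])
open import Data.List.Base as List using (List; cartesianProductWith)
open import Data.List.Extrema.Nat using (max; xs≤max; argmax-sel)
open import Data.List.Membership.Propositional using (_∈_)
open import Data.List.Membership.Propositional.Properties
  using (∈-cartesianProductWith⁺; ∈-filter⁺; ∈-filter⁻; ∈-map⁺; ∈-map⁻)
open import Data.List.Relation.Unary.Any using (here; there)
import Data.List.Relation.Unary.All as ListAll
open import Data.Nat.Base
open import Data.Nat.Properties using (m<n⇒0<n∸m; n≤0⇒n≡0; ≤-trans; ≤-reflexive)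
import Data.Nat.Properties as ℕ
open import Data.Product.Base using (∃; ∃-syntax; _×_; _,_; proj₂)
open import Data.Rational.Unnormalised.Base as ℚᵘ using (ℚᵘ; mkℚᵘ)
open import Data.Sum.Base using (inj₁; inj₂)
open import Data.Vec.Base as Vec using (Vec; []; _∷_; replicate; sum)
open import Data.Vec.Properties using (≡-dec)
open import Data.Vec.Relation.Binary.Pointwise.Inductive as Pointwise using (Pointwise)
open import Data.Vec.Relation.Unary.All using (All; []; _∷_)
open import Function.Base using (id)
open import Relation.Binary.PropositionalEquality using (_≡_; refl; sym; subst)
open import Relation.Nullary using (¬_; Dec; ¬?; map′; _×-dec_)
open import Relation.Unary using (Decidable)

private
  variable
    d n : ℕ

Matrix : Vec ℕ d → Set
Matrix []       = Bool
Matrix (n ∷ ns) = Vec (Matrix ns) n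

ones : (ns : Vec ℕ d) → Matrix ns → ℕ
ones []       a = if a then 1 else 0
ones (n ∷ ns) A = sum (Vec.map (ones ns) A)

R : (ks : Vec ℕ d) → Matrix ks
R []       = true
R (k ∷ ks) = replicate k (R ks)

-- A choice, for each ℓ, of a set of values of the ℓ-th coordinate.
Selection : Vec ℕ d → Set
Selection = All Subset

sizes : {ns : Vec ℕ d} → Selection ns → Vec ℕ d
sizes []       = []
sizes (S ∷ Ss) = ∣ S ∣ ∷ sizes Ss

select : {A : Set} (S : Subset n) → Vec A n → Vec A ∣ S ∣
select []            []       = []
select (inside  ∷ S) (x ∷ xs) = x ∷ select S xs
select (outside ∷ S) (x ∷ xs) = select S xs

submatrix : {ns : Vec ℕ d} (Ss : Selection ns) → Matrix ns → Matrix (sizes Ss)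
submatrix []       a = a
submatrix (S ∷ Ss) A = Vec.map (submatrix Ss) (select S A)

-- The entrywise order: P arises from B by changing ones to zeros.  The shapes
-- ks and ms are kept separate only to avoid transport in Contains, which
-- requires them to be equal.
Below : (ks : Vec ℕ d) → Matrix ks → (ms : Vec ℕ d) → Matrix ms → Set
Below []       p []       b = p Bool.≤ b
Below (k ∷ ks) P (m ∷ ms) B = Pointwise (λ P′ B′ → Below ks P′ ms B′) P B

Contains : (ns : Vec ℕ d) → Matrix ns → (ks : Vec ℕ d) → Matrix ks → Set
Contains ns A ks P =
  ∃[ Ss ] sizes {ns = ns} Ss ≡ ks × Below ks P (sizes Ss) (submatrix Ss A)

Avoids : (ns : Vec ℕ d) → Matrix ns → (ks : Vec ℕ d) → Matrix ks → Set
Avoids ns A ks P = ¬ Contains ns A ks P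

below? : (ks : Vec ℕ d) (P : Matrix ks) (ms : Vec ℕ d) (B : Matrix ms) →
         Dec (Below ks P ms B)
below? []       p []       b = p Bool.≤? b
below? (k ∷ ks) P (m ∷ ms) B = Pointwise.decidable (λ P′ B′ → below? ks P′ ms B′) P B

anySelection? : (ns : Vec ℕ d) {Q : Selection ns → Set} → Decidable Q → Dec (∃ Q)
anySelection? []       Q? = map′ ([] ,_) (λ { ([] , q) → q }) (Q? [])
anySelection? (n ∷ ns) Q? =
  map′ (λ { (S , Ss , q) → S ∷ Ss , q }) (λ { (S ∷ Ss , q) → S , Ss , q })
       (anySubset? λ S → anySelection? ns λ Ss → Q? (S ∷ Ss))

contains? : (ns : Vec ℕ d) (A : Matrix ns) (ks : Vec ℕ d) (P : Matrix ks) →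
            Dec (Contains ns A ks P)
contains? ns A ks P =
  anySelection? ns λ Ss →
    ≡-dec ℕ._≟_ (sizes Ss) ks ×-dec below? ks P (sizes Ss) (submatrix Ss A)

avoids? : (ns ks : Vec ℕ d) (P : Matrix ks) → Decidable (λ A → Avoids ns A ks P)
avoids? ns ks P A = ¬? (contains? ns A ks P)

allVecs : {A : Set} → List A → (n : ℕ) → List (Vec A n)
allVecs xs zero    = List.[ [] ]
allVecs xs (suc n) = cartesianProductWith _∷_ xs (allVecs xs n)

allMatrices : (ns : Vec ℕ d) → List (Matrix ns)
allMatrices []       = false List.∷ true List.∷ List.[]
allMatrices (n ∷ ns) = allVecs (allMatrices ns) n

cube : (d n : ℕ) → Vec ℕ d
cube d n = replicate d n

avoiders : (n : ℕ) (ks : Vec ℕ d) → Matrix ks → List (Matrix (cube d n))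
avoiders {d} n ks P = List.filter (avoids? (cube d n) ks P) (allMatrices (cube d n))

-- The value is 0 by convention in the case, excluded when P has a one,
-- that no matrix avoids P; otherwise f-upper and f-attained characterise it.
f : (n : ℕ) (ks : Vec ℕ d) → Matrix ks → ℕ
f {d} n ks P = max 0 (List.map (ones (cube d n)) (avoiders n ks P))

∈-allVecs : {A : Set} {xs : List A} → (∀ x → x ∈ xs) → (v : Vec A n) → v ∈ allVecs xs n
∈-allVecs all []      = here refl
∈-allVecs all (x ∷ v) = ∈-cartesianProductWith⁺ _∷_ (all x) (∈-allVecs all v)

∈-allMatrices : (ns : Vec ℕ d) (A : Matrix ns) → A ∈ allMatrices ns
∈-allMatrices []       false = here refl
∈-allMatrices []       true  = there (here refl)
∈-allMatrices (n ∷ ns) A     = ∈-allVecs (∈-allMatrices ns) A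

module _ (n : ℕ) (ks : Vec ℕ d) (P : Matrix ks) where

  f-upper : (A : Matrix (cube d n)) → Avoids (cube d n) A ks P →
            ones (cube d n) A ≤ f n ks P
  f-upper A av = ListAll.lookup (xs≤max 0 _)
    (∈-map⁺ (ones _) (∈-filter⁺ (avoids? _ ks P) (∈-allMatrices (cube d n) A) av))

  f-attained : ∃[ A ] Avoids (cube d n) A ks P →
               ∃[ A ] Avoids (cube d n) A ks P × ones (cube d n) A ≡ f n ks P
  f-attained (A , av)
    with argmax-sel id 0 (List.map (ones (cube d n)) (avoiders n ks P))
  ... | inj₁ f≡0 = A , av , subst (ones _ A ≡_) (sym f≡0)
                              (n≤0⇒n≡0 (≤-trans (f-upper A av) (≤-reflexive f≡0)))
  ... | inj₂ f∈ with ∈-map⁻ (ones _) f∈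
  ...   | B , B∈ , f≡ =
    B , proj₂ (∈-filter⁻ (avoids? _ ks P) {xs = allMatrices (cube d n)} B∈) , sym f≡

product : Vec ℕ d → ℕ
product = Vec.foldr _ _*_ 1

β : (ks : Vec ℕ d) → 1 < product ks → ℚᵘ
β {d} ks 1<Πk = ((+ sum ks ℤ.- + d) ℚᵘ./ (product ks ∸ 1))
                  {{>-nonZero (m<n⇒0<n∸m 1<Πk)}}

-- The real inequality n^r ≤ y, for n ≥ 1: raise both sides to the power of the
-- denominator of r and, if r is negative, multiply out n^|r|.
infix 4 _^[_]≤_
_^[_]≤_ : ℕ → ℚᵘ → ℕ → Set
n ^[ mkℚᵘ (+ a)    b-1 ]≤ y = n ^ a ≤ y ^ suc b-1
n ^[ mkℚᵘ -[1+ a ] b-1 ]≤ y = 1 ≤ n ^ suc a * y ^ suc b-1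

-- g(n) = Ω(n^r).  The implied constant is written 1/C: any positive real
-- constant may be decreased to one of this form.
_∈Ω[n^_] : (ℕ → ℕ) → ℚᵘ → Set
g ∈Ω[n^ r ] = ∃[ C ] 1 ≤ C × ∃[ N ] (∀ n → N ≤ n → n ^[ r ]≤ C * g n)

{-# OPTIONS --safe #-}
-- The boxes to be avoided are the edges of a hypergraph on the n^d positions:
-- with K = k₁⋯k_d it is K-uniform and has at most n^(k₁+⋯+k_d) edges.  A random
-- set of positions of density 1/q is, after deletion of one position from each
-- edge it contains, an independent set of expected size at least N/q − E/q^K,
-- where N = n^d and E is the number of edges; taking q of order n^β gives the
-- bound.  The random choice is derandomised by conditional expectations: an
-- edge of which i positions remain undecided, the others being chosen, weighs
-- q^(−i), and a position is taken iff the edges through it weigh less than 1/q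
-- in total.  A completed edge would weigh 1, so the greedy set is already
-- independent.
module Submission where

open import Defs
open import Data.Bool.Base as Bool using (true; false; if_then_else_)
open import Data.Fin.Subset using (Subset; inside; outside; ∣_∣; ⊥)
open import Data.Fin.Subset.Properties using (∣⊥∣≡0)
open import Data.Integer.Base as ℤ using (+_)
import Data.Integer.Properties as ℤ
open import Data.List.Base as List using (List; []; _∷_; length; cartesianProductWith)
open import Data.List.Membership.Propositional using (_∈_)
open import Data.List.Membership.Propositional.Properties
  using (∈-cartesianProductWith⁺; ∈-map⁺; ∈-++⁺ˡ; ∈-++⁺ʳ)
import Data.List.Properties as List
open import Data.List.Relation.Unary.All as ListAll using ([]; _∷_)
import Data.List.Relation.Unary.All.Properties as ListAll
open import Data.List.Relation.Unary.Any using (here)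
open import Data.Nat.Base
  using (ℕ; zero; suc; _+_; _*_; _^_; _∸_; _≤_; _<_; z≤n; s≤s; s≤s⁻¹; NonZero; >-nonZero; >-nonZero⁻¹)
open import Data.Nat.Properties
open import Data.Nat.Tactic.RingSolver using (solve-∀)
open import Data.Product.Base using (∃-syntax; _×_; _,_; proj₁; proj₂)
open import Data.Rational.Unnormalised.Base using (_-_; _/_)
open import Data.Vec.Base as Vec using (Vec; []; _∷_; _++_; concat; group; sum; tail)
open import Data.Vec.Properties using (map-∘; map-cong; map-id)
open import Data.Vec.Relation.Binary.Pointwise.Inductive as Pointwise using (Pointwise; []; _∷_)
open import Data.Vec.Relation.Unary.All using (All; []; _∷_)
open import Function.Base using (_∘_; id)
open import Relation.Binary.PropositionalEquality
open import Relation.Nullary using (¬_; contradiction; yes; no)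

private
  variable
    d m n : ℕ

-- Hypergraphs on n positions, and the effect of deciding the first one.

infix 4 _⊑_
_⊑_ : Subset n → Subset n → Set
_⊑_ = Pointwise Bool._≤_

Independent : List (Subset n) → Subset n → Set
Independent es S = ListAll.All (λ e → ¬ e ⊑ S) es

-- Weights are scaled by q^n: the weight of e is q^(n − ∣e∣).
weight : ℕ → Subset n → ℕ
weight q []            = 1
weight q (inside  ∷ e) = weight q e
weight q (outside ∷ e) = q * weight q e

weight*q^∣e∣≡q^n : ∀ q (e : Subset n) → weight q e * q ^ ∣ e ∣ ≡ q ^ n
weight*q^∣e∣≡q^n q []            = refl
weight*q^∣e∣≡q^n {suc n} q (inside  ∷ e) =
  trans (swap (weight q e) q (q ^ ∣ e ∣)) (cong (q *_) (weight*q^∣e∣≡q^n q e))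
  where
  swap : ∀ w q x → w * (q * x) ≡ q * (w * x)
  swap = solve-∀
weight*q^∣e∣≡q^n q (outside ∷ e) =
  trans (*-assoc q _ _) (cong (q *_) (weight*q^∣e∣≡q^n q e))

totalWeight : ℕ → List (Subset n) → ℕ
totalWeight q []       = 0
totalWeight q (e ∷ es) = weight q e + totalWeight q es

-- If the first position is taken, the tails of all edges remain to be avoided. If it is skipped,
-- the edges through it can no longer be completed and only `deletion` remains.
link : List (Subset (suc n)) → List (Subset n)
link []                   = []
link ((inside  ∷ e) ∷ es) = e ∷ link es
link ((outside ∷ e) ∷ es) = link es

deletion : List (Subset (suc n)) → List (Subset n)
deletion []                   = []
deletion ((inside  ∷ e) ∷ es) = deletion es
deletion ((outside ∷ e) ∷ es) = e ∷ deletion es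

-- The scale drops from q^(n+1) to q^n. An edge in the deletion keeps its true weight, hence the
-- factor q; an edge through the position gains a factor q once the position is taken, which cancels
-- the change of scale.
totalWeight-split : ∀ q (es : List (Subset (suc n))) →
  totalWeight q es ≡ totalWeight q (link es) + q * totalWeight q (deletion es)
totalWeight-split q []                   = sym (*-zeroʳ q)
totalWeight-split q ((inside  ∷ e) ∷ es) =
  trans (cong (_+_ (weight q e)) (totalWeight-split q es)) (sym (+-assoc (weight q e) _ _))
totalWeight-split q ((outside ∷ e) ∷ es) =
  trans (cong (_+_ (q * weight q e)) (totalWeight-split q es))
        (shuffle q (weight q e) (totalWeight q (link es)) _)
  where
  shuffle : ∀ q w a b → q * w + (a + q * b) ≡ a + q * (w + b)
  shuffle = solve-∀

totalWeight-tails : ∀ q (es : List (Subset (suc n))) →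
  totalWeight q (List.map tail es) ≡ totalWeight q (link es) + totalWeight q (deletion es)
totalWeight-tails q []                   = refl
totalWeight-tails q ((inside  ∷ e) ∷ es) =
  trans (cong (_+_ (weight q e)) (totalWeight-tails q es)) (sym (+-assoc (weight q e) _ _))
totalWeight-tails q ((outside ∷ e) ∷ es) =
  trans (cong (_+_ (weight q e)) (totalWeight-tails q es))
        (shuffle (weight q e) (totalWeight q (link es)) _)
  where
  shuffle : ∀ w a b → w + (a + b) ≡ a + (w + b)
  shuffle = solve-∀

independent-inside : ∀ (es : List (Subset (suc n))) {S} →
  Independent (List.map tail es) S → Independent es (inside ∷ S)
independent-inside es ind =
  ListAll.map (λ { {_ ∷ _} ¬e⊑S (_ ∷ e⊑S) → ¬e⊑S e⊑S }) (ListAll.map⁻ {xs = es} ind)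

independent-outside : ∀ (es : List (Subset (suc n))) {S} →
  Independent (deletion es) S → Independent es (outside ∷ S)
independent-outside []                   []          = []
independent-outside ((inside  ∷ e) ∷ es) ind         =
  (λ { (() ∷ _) }) ∷ independent-outside es ind
independent-outside ((outside ∷ e) ∷ es) (¬e⊑S ∷ ind) =
  (λ { (_ ∷ e⊑S) → ¬e⊑S e⊑S }) ∷ independent-outside es ind

NonEmpty : Subset n → Set
NonEmpty e = 1 ≤ ∣ e ∣

weight<q^n⇒nonEmpty : ∀ q (e : Subset n) → weight q e < q ^ n → NonEmpty e
weight<q^n⇒nonEmpty q e w<q^n with ∣ e ∣ | weight*q^∣e∣≡q^n q e
... | zero  | eq = contradiction (trans (sym (*-identityʳ _)) eq) (<⇒≢ w<q^n)
... | suc _ | _  = s≤s z≤n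

-- An edge completed by taking the position would leave an empty tail, whose scaled weight q^n alone
-- violates the threshold.
tails-nonEmpty : ∀ q (es : List (Subset (suc n))) → totalWeight q (link es) < q ^ n →
  ListAll.All NonEmpty es → ListAll.All NonEmpty (List.map tail es)
tails-nonEmpty q []                   _   []         = []
tails-nonEmpty q ((inside  ∷ e) ∷ es) w<Q (_  ∷ nes) =
  weight<q^n⇒nonEmpty q e (≤-<-trans (m≤m+n _ _) w<Q)
  ∷ tails-nonEmpty q es (≤-<-trans (m≤n+m _ (weight q e)) w<Q) nes
tails-nonEmpty q ((outside ∷ e) ∷ es) w<Q (ne ∷ nes) = ne ∷ tails-nonEmpty q es w<Q nes

deletion-nonEmpty : ∀ (es : List (Subset (suc n))) →
  ListAll.All NonEmpty es → ListAll.All NonEmpty (deletion es)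
deletion-nonEmpty []                   []         = []
deletion-nonEmpty ((inside  ∷ e) ∷ es) (_  ∷ nes) = deletion-nonEmpty es nes
deletion-nonEmpty ((outside ∷ e) ∷ es) (ne ∷ nes) = ne ∷ deletion-nonEmpty es nes

-- The greedy independent set.

module _ (p : ℕ) where
  private
    -- The successor form makes q positive and gives q - 1 as `p`, free of truncated subtraction.
    q : ℕ
    q = suc p

  -- In both steps Q = q^n, while a and b are the weights of the edges that
  -- contain, respectively do not contain, the position being decided.
  take-step : ∀ n Q s a b → a ≤ Q → n * Q ≤ q * (Q * s + (a + b)) →
    suc n * (q * Q) ≤ q * (q * Q * suc s + (a + q * b))
  take-step n Q s a b a≤Q ih = begin
    suc n * (q * Q)                             ≡⟨ lhs n p Q ⟩
    q * Q + q * (n * Q)                         ≤⟨ +-monoʳ-≤ (q * Q) (*-monoʳ-≤ q ih) ⟩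
    q * Q + q * (q * (Q * s + (a + b)))         ≡⟨ mid p Q s a b ⟩
    q * (q * Q * s + Q + a + q * b + p * a)     ≤⟨ *-monoʳ-≤ q (+-monoʳ-≤ _ (*-monoʳ-≤ p a≤Q)) ⟩
    q * (q * Q * s + Q + a + q * b + p * Q)     ≡⟨ rhs p Q s a b ⟩
    q * (q * Q * suc s + (a + q * b))           ∎
    where
    open ≤-Reasoning
    lhs : ∀ n p Q → suc n * (suc p * Q) ≡ suc p * Q + suc p * (n * Q)
    lhs = solve-∀
    mid : ∀ p Q s a b → suc p * Q + suc p * (suc p * (Q * s + (a + b))) ≡
      suc p * (suc p * Q * s + Q + a + suc p * b + p * a)
    mid = solve-∀
    rhs : ∀ p Q s a b → suc p * (suc p * Q * s + Q + a + suc p * b + p * Q) ≡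
      suc p * (suc p * Q * suc s + (a + suc p * b))
    rhs = solve-∀

  skip-step : ∀ n Q s a b → Q ≤ a → n * Q ≤ q * (Q * s + b) →
    suc n * (q * Q) ≤ q * (q * Q * s + (a + q * b))
  skip-step n Q s a b Q≤a ih = begin
    suc n * (q * Q)                   ≡⟨ lhs n p Q ⟩
    q * Q + q * (n * Q)               ≤⟨ +-mono-≤ (*-monoʳ-≤ q Q≤a) (*-monoʳ-≤ q ih) ⟩
    q * a + q * (q * (Q * s + b))     ≡⟨ rhs p Q s a b ⟩
    q * (q * Q * s + (a + q * b))     ∎
    where
    open ≤-Reasoning
    lhs : ∀ n p Q → suc n * (suc p * Q) ≡ suc p * Q + suc p * (n * Q)
    lhs = solve-∀
    rhs : ∀ p Q s a b → suc p * a + suc p * (suc p * (Q * s + b)) ≡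
      suc p * (suc p * Q * s + (a + suc p * b))
    rhs = solve-∀

  -- Divided by q * q^n, the bound reads n/q ≤ ∣S∣ + W, where W is the sum of q^(-∣e∣) over the
  -- edges.
  greedy : (es : List (Subset n)) → ListAll.All NonEmpty es →
    ∃[ S ] Independent es S × n * q ^ n ≤ q * (q ^ n * ∣ S ∣ + totalWeight q es)
  greedy {zero}  []        _        = [] , [] , z≤n
  greedy {zero}  ([] ∷ es) (() ∷ _)
  -- Let L be the weight of the link in units of q^n. Taking the position adds 1 to the size and L(1
  -- - 1/q) to the weight; skipping it removes L/q from the weight. Either way size minus weight
  -- gains at least 1/q, exactly because the choice is made by comparing L with 1.
  greedy {suc n} es        nes with totalWeight q (link es) <? q ^ n
  ... | yes w<Q with greedy (List.map tail es) (tails-nonEmpty q es w<Q nes)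
  ...   | S , ind , large rewrite totalWeight-tails q es | totalWeight-split q es =
    inside ∷ S , independent-inside es ind ,
    take-step n (q ^ n) ∣ S ∣ _ (totalWeight q (deletion es)) (<⇒≤ w<Q) large
  greedy {suc n} es nes | no w≮Q with greedy (deletion es) (deletion-nonEmpty es nes)
  ...   | S , ind , large rewrite totalWeight-split q es =
    outside ∷ S , independent-outside es ind ,
    skip-step n (q ^ n) ∣ S ∣ _ (totalWeight q (deletion es)) (≮⇒≥ w≮Q) large

  totalWeight-uniform : ∀ k (es : List (Subset n)) → ListAll.All (λ e → ∣ e ∣ ≡ k) es →
    totalWeight q es * q ^ k ≡ length es * q ^ n
  totalWeight-uniform k []       []           = refl
  totalWeight-uniform k (e ∷ es) (refl ∷ unif) =
    trans (*-distribʳ-+ (q ^ ∣ e ∣) (weight q e) _)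
          (cong₂ _+_ (weight*q^∣e∣≡q^n q e) (totalWeight-uniform k es unif))

  -- Here W is the number of edges over q^(k+1), so the greedy bound is multiplied by q^(k+1). Edges
  -- of size `suc k` are nonempty, as `greedy` requires.
  uniform-independent : ∀ k (es : List (Subset n)) → ListAll.All (λ e → ∣ e ∣ ≡ suc k) es →
    ∃[ S ] Independent es S × n * q ^ k ≤ q * q ^ k * ∣ S ∣ + length es
  uniform-independent {n} k es unif
    with greedy es (ListAll.map (λ eq → subst (1 ≤_) (sym eq) (s≤s z≤n)) unif)
  ... | S , ind , large = S , ind ,
    *-cancelˡ-≤ (q * q ^ n) {{m^n≢0 q (suc n)}} (begin
      q * q ^ n * (n * q ^ k)                               ≡⟨ lhs q (q ^ n) n (q ^ k) ⟩
      n * q ^ n * (q * q ^ k)                               ≤⟨ *-monoˡ-≤ (q * q ^ k) large ⟩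
      q * (q ^ n * ∣ S ∣ + W) * (q * q ^ k)                 ≡⟨ mid q (q ^ n) ∣ S ∣ W (q ^ k) ⟩
      q * (q ^ n * (q * q ^ k * ∣ S ∣) + W * (q * q ^ k))
        ≡⟨ cong (λ x → q * (q ^ n * (q * q ^ k * ∣ S ∣) + x)) (totalWeight-uniform (suc k) es unif) ⟩
      q * (q ^ n * (q * q ^ k * ∣ S ∣) + length es * q ^ n)
        ≡⟨ rhs q (q ^ n) (q * q ^ k * ∣ S ∣) (length es) ⟩
      q * q ^ n * (q * q ^ k * ∣ S ∣ + length es)           ∎)
    where
    open ≤-Reasoning
    W : ℕ
    W = totalWeight q es
    lhs : ∀ q Q n K → q * Q * (n * K) ≡ n * Q * (q * K)
    lhs = solve-∀
    mid : ∀ q Q s W K → q * (Q * s + W) * (q * K) ≡ q * (Q * (q * K * s) + W * (q * K))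
    mid = solve-∀
    rhs : ∀ q Q x E → q * (Q * x + E * Q) ≡ q * Q * (x + E)
    rhs = solve-∀

-- Matrices as sets of positions, in row-major order.

∣++∣ : (S : Subset m) (T : Subset n) → ∣ S ++ T ∣ ≡ ∣ S ∣ + ∣ T ∣
∣++∣ []            T = refl
∣++∣ (inside  ∷ S) T = cong suc (∣++∣ S T)
∣++∣ (outside ∷ S) T = ∣++∣ S T

flatten : (ns : Vec ℕ d) → Matrix ns → Subset (product ns)
flatten []       a = a ∷ []
flatten (n ∷ ns) A = concat (Vec.map (flatten ns) A)

flatten-surjective : (ns : Vec ℕ d) (S : Subset (product ns)) → ∃[ A ] flatten ns A ≡ S
flatten-surjective []       (b ∷ []) = b , refl
flatten-surjective (n ∷ ns) S with group n (product ns) S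
... | rows , refl = Vec.map (proj₁ ∘ flatten-surjective ns) rows , cong concat (begin
  Vec.map (flatten ns) (Vec.map (proj₁ ∘ flatten-surjective ns) rows)  ≡⟨ map-∘ _ _ rows ⟨
  Vec.map (flatten ns ∘ proj₁ ∘ flatten-surjective ns) rows
    ≡⟨ map-cong (proj₂ ∘ flatten-surjective ns) rows ⟩
  Vec.map id rows                                                      ≡⟨ map-id rows ⟩
  rows                                                                 ∎)
  where open ≡-Reasoning

ones≡∣flatten∣ : (ns : Vec ℕ d) (A : Matrix ns) → ones ns A ≡ ∣ flatten ns A ∣
ones≡∣flatten∣ []       false = refl
ones≡∣flatten∣ []       true  = refl
ones≡∣flatten∣ (n ∷ ns) A     = rows A
  where
  rows : ∀ {n} (A : Matrix (n ∷ ns)) → ones (n ∷ ns) A ≡ ∣ flatten (n ∷ ns) A ∣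
  rows []      = refl
  rows (B ∷ A) = trans (cong₂ _+_ (ones≡∣flatten∣ ns B) (rows A))
                       (sym (∣++∣ (flatten ns B) (flatten (_ ∷ ns) A)))

-- Boxes as product sets.

infixr 7 _⊗_
-- In row-major order this is the Cartesian product of `S` and `e`.
_⊗_ : Subset n → Subset m → Subset (n * m)
S ⊗ e = concat (Vec.map (λ b → if b then e else ⊥) S)

∣⊗∣ : (S : Subset n) (e : Subset m) → ∣ S ⊗ e ∣ ≡ ∣ S ∣ * ∣ e ∣
∣⊗∣ []            e = refl
∣⊗∣ (inside  ∷ S) e = trans (∣++∣ e (S ⊗ e)) (cong (_+_ ∣ e ∣) (∣⊗∣ S e))
∣⊗∣ {m = m} (outside ∷ S) e =
  trans (∣++∣ (⊥ {m}) (S ⊗ e)) (cong₂ _+_ (∣⊥∣≡0 m) (∣⊗∣ S e))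

⊥⊑ : (S : Subset n) → ⊥ ⊑ S
⊥⊑ []          = []
⊥⊑ (true  ∷ S) = Bool.f≤t ∷ ⊥⊑ S
⊥⊑ (false ∷ S) = Bool.b≤b ∷ ⊥⊑ S

box : {ns : Vec ℕ d} → Selection ns → Subset (product ns)
box []       = inside ∷ []
box (S ∷ Ss) = S ⊗ box Ss

-- A selected row supplies the inclusion of one copy of `box Ss`; an unselected row faces an empty
-- block, which lies below anything.
below⇒box⊑flatten : (ns : Vec ℕ d) (Ss : Selection ns) (A : Matrix ns) →
  Below (sizes Ss) (R (sizes Ss)) (sizes Ss) (submatrix Ss A) → box Ss ⊑ flatten ns A
below⇒box⊑flatten []       []       A true≤A = true≤A ∷ []
below⇒box⊑flatten (n ∷ ns) (S ∷ Ss) A below  = rows S A below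
  where
  rows : ∀ {n} (S : Subset n) (A : Matrix (n ∷ ns)) →
    Below (∣ S ∣ ∷ sizes Ss) (R (∣ S ∣ ∷ sizes Ss)) (∣ S ∣ ∷ sizes Ss) (submatrix (S ∷ Ss) A) →
    S ⊗ box Ss ⊑ flatten (n ∷ ns) A
  rows []            []      []        = []
  rows (inside  ∷ S) (B ∷ A) (b ∷ bs)  = Pointwise.++⁺ (below⇒box⊑flatten ns Ss B b) (rows S A bs)
  rows (outside ∷ S) (B ∷ A) bs        = Pointwise.++⁺ (⊥⊑ (flatten ns B)) (rows S A bs)

-- Enumerating and counting the boxes.

subsetsOfSize : ∀ n → ℕ → List (Subset n)
subsetsOfSize zero    zero    = [] ∷ []
subsetsOfSize zero    (suc k) = []
subsetsOfSize (suc n) zero    = List.map (outside ∷_) (subsetsOfSize n zero)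
subsetsOfSize (suc n) (suc k) =
  List.map (inside ∷_) (subsetsOfSize n k) List.++ List.map (outside ∷_) (subsetsOfSize n (suc k))

∈-subsetsOfSize : (S : Subset n) → S ∈ subsetsOfSize n ∣ S ∣
∈-subsetsOfSize []            = here refl
∈-subsetsOfSize (inside  ∷ S) = ∈-++⁺ˡ (∈-map⁺ (inside ∷_) (∈-subsetsOfSize S))
∈-subsetsOfSize (outside ∷ S) with ∣ S ∣ | ∈-subsetsOfSize S
... | zero  | S∈ = ∈-map⁺ (outside ∷_) S∈
... | suc _ | S∈ = ∈-++⁺ʳ _ (∈-map⁺ (outside ∷_) S∈)

subsetsOfSize-size : ∀ n k → ListAll.All (λ S → ∣ S ∣ ≡ k) (subsetsOfSize n k)
subsetsOfSize-size zero    zero    = refl ∷ []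
subsetsOfSize-size zero    (suc k) = []
subsetsOfSize-size (suc n) zero    = ListAll.map⁺ (subsetsOfSize-size n zero)
subsetsOfSize-size (suc n) (suc k) = ListAll.++⁺
  (ListAll.map⁺ (ListAll.map (cong suc) (subsetsOfSize-size n k)))
  (ListAll.map⁺ (subsetsOfSize-size n (suc k)))

-- By Pascal's rule the bounds n^k and n^(k+1) add up to (n+1) * n^k, which is at most (n+1)^(k+1).
length-subsetsOfSize : ∀ n k → length (subsetsOfSize n k) ≤ n ^ k
length-subsetsOfSize zero    zero    = ≤-refl
length-subsetsOfSize zero    (suc k) = z≤n
length-subsetsOfSize (suc n) zero    =
  ≤-trans (≤-reflexive (List.length-map _ (subsetsOfSize n zero))) (length-subsetsOfSize n zero)
length-subsetsOfSize (suc n) (suc k) = begin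
  length (subsetsOfSize (suc n) (suc k))
    ≡⟨ List.length-++ (List.map (inside ∷_) (subsetsOfSize n k)) ⟩
  length (List.map (inside ∷_) (subsetsOfSize n k))
    + length (List.map (outside ∷_) (subsetsOfSize n (suc k)))
    ≡⟨ cong₂ _+_ (List.length-map _ (subsetsOfSize n k)) (List.length-map _ (subsetsOfSize n (suc k))) ⟩
  length (subsetsOfSize n k) + length (subsetsOfSize n (suc k))
    ≤⟨ +-mono-≤ (length-subsetsOfSize n k) (length-subsetsOfSize n (suc k)) ⟩
  suc n * n ^ k
    ≤⟨ *-monoʳ-≤ (suc n) (^-monoˡ-≤ k (n≤1+n n)) ⟩
  suc n ^ suc k ∎
  where open ≤-Reasoning

boxes : (ns ks : Vec ℕ d) → List (Subset (product ns))
boxes []       []       = (inside ∷ []) ∷ []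
boxes (n ∷ ns) (k ∷ ks) = cartesianProductWith _⊗_ (subsetsOfSize n k) (boxes ns ks)

box∈boxes : (ns : Vec ℕ d) (Ss : Selection ns) → box Ss ∈ boxes ns (sizes Ss)
box∈boxes []       []       = here refl
box∈boxes (n ∷ ns) (S ∷ Ss) = ∈-cartesianProductWith⁺ _⊗_ (∈-subsetsOfSize S) (box∈boxes ns Ss)

boxes-size : (ns ks : Vec ℕ d) → ListAll.All (λ e → ∣ e ∣ ≡ product ks) (boxes ns ks)
boxes-size []       []       = refl ∷ []
boxes-size (n ∷ ns) (k ∷ ks) =
  ListAll.cartesianProductWith⁺ (setoid _) (setoid _) _⊗_ (subsetsOfSize n k) (boxes ns ks)
    λ {S} {e} S∈ e∈ → trans (∣⊗∣ S e)
      (cong₂ _*_ (ListAll.lookup (subsetsOfSize-size n k) S∈) (ListAll.lookup (boxes-size ns ks) e∈))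

length-cartesianProductWith : ∀ {A B C : Set} (g : A → B → C) (xs : List A) (ys : List B) →
  length (cartesianProductWith g xs ys) ≡ length xs * length ys
length-cartesianProductWith g []       ys = refl
length-cartesianProductWith g (x ∷ xs) ys =
  trans (List.length-++ (List.map (g x) ys))
        (cong₂ _+_ (List.length-map (g x) ys) (length-cartesianProductWith g xs ys))

length-boxes : ∀ n (ks : Vec ℕ d) → length (boxes (cube d n) ks) ≤ n ^ sum ks
length-boxes         n []       = ≤-refl
length-boxes {suc d} n (k ∷ ks) = begin
  length (boxes (n ∷ cube d n) (k ∷ ks))
    ≡⟨ length-cartesianProductWith _⊗_ (subsetsOfSize n k) (boxes (cube d n) ks) ⟩
  length (subsetsOfSize n k) * length (boxes (cube d n) ks)
    ≤⟨ *-mono-≤ (length-subsetsOfSize n k) (length-boxes n ks) ⟩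
  n ^ k * n ^ sum ks  ≡⟨ ^-distribˡ-+-* n k (sum ks) ⟨
  n ^ (k + sum ks)    ∎
  where open ≤-Reasoning

-- From independent sets to matrices that avoid `R ks`.

independent⇒avoids : (ns ks : Vec ℕ d) (A : Matrix ns) →
  Independent (boxes ns ks) (flatten ns A) → Avoids ns A ks (R ks)
independent⇒avoids ns _ A ind (Ss , refl , below) =
  ListAll.lookup ind (box∈boxes ns Ss) (below⇒box⊑flatten ns Ss A below)

independent⇒∣S∣≤f : ∀ n (ks : Vec ℕ d) (S : Subset (product (cube d n))) →
  Independent (boxes (cube d n) ks) S → ∣ S ∣ ≤ f n ks (R ks)
independent⇒∣S∣≤f {d} n ks S ind with flatten-surjective (cube d n) S
... | A , refl = subst (_≤ f n ks (R ks)) (ones≡∣flatten∣ (cube d n) A)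
                       (f-upper n ks (R ks) A (independent⇒avoids (cube d n) ks A ind))

-- The choice of q and the resulting bound on `f`.

product-cube : ∀ d n → product (cube d n) ≡ n ^ d
product-cube zero    n = refl
product-cube (suc d) n = cong (n *_) (product-cube d n)

^-distribʳ-* : ∀ k x y → (x * y) ^ k ≡ x ^ k * y ^ k
^-distribʳ-* zero    x y = refl
^-distribʳ-* (suc k) x y =
  trans (cong (x * y *_) (^-distribʳ-* k x y)) (interchange x y (x ^ k) (y ^ k))
  where
  interchange : ∀ x y a b → x * y * (a * b) ≡ x * a * (y * b)
  interchange = solve-∀

-- Induction on X: the root is kept while its power still reaches X and is doubled otherwise.
-- Doubling occurs only when the power equals the previous X, so the new power is exactly 2^k times
-- that value.
approximate-root : ∀ k .{{_ : NonZero k}} X .{{_ : NonZero X}} →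
  ∃[ p ] X ≤ suc p ^ k × suc p ^ k ≤ 2 ^ k * X
approximate-root k (suc zero) =
  0 , ≤-reflexive (sym (^-zeroˡ k)) ,
  subst (_≤ 2 ^ k * 1) (sym (^-zeroˡ k)) (≤-trans (m^n>0 2 k) (≤-reflexive (sym (*-identityʳ _))))
approximate-root k (suc (suc X)) with approximate-root k (suc X)
... | p , X≤ , ≤X with suc (suc X) ≤? suc p ^ k
...   | yes 1+X≤ = p , 1+X≤ , ≤-trans ≤X (*-monoʳ-≤ (2 ^ k) (n≤1+n (suc X)))
-- The predecessor of `2 * suc p`, in the form to which it computes.
...   | no  1+X≰ = p + suc (p + 0) ,
  (begin
    suc (suc X)        ≤⟨ s≤s (m≤n+m (suc X) X) ⟩
    suc (X + suc X)    ≡⟨ double X ⟩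
    2 * suc X          ≤⟨ *-monoˡ-≤ (suc X) (^-monoʳ-≤ 2 (>-nonZero⁻¹ k)) ⟩
    2 ^ k * suc X      ≡⟨ doubled ⟨
    (2 * suc p) ^ k    ∎) ,
  ≤-trans (≤-reflexive doubled) (*-monoʳ-≤ (2 ^ k) (n≤1+n (suc X)))
  where
  open ≤-Reasoning
  root : suc p ^ k ≡ suc X
  root = ≤-antisym (s≤s⁻¹ (≰⇒> 1+X≰)) X≤
  doubled : (2 * suc p) ^ k ≡ 2 ^ k * suc X
  doubled = trans (^-distribʳ-* k 2 (suc p)) (cong (2 ^ k *_) root)
  double : ∀ X → suc (X + suc X) ≡ 2 * suc X
  double = solve-∀

-- Here t/k is β, and the inequality is the k-th power of n^d ≤ 8 * f * n^β, cleared of roots.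
f-lower : ∀ n .{{_ : NonZero n}} (ks : Vec ℕ d) k .{{_ : NonZero k}} t → product ks ≡ suc k →
  sum ks ≡ t + d → n ^ (d * k) ≤ (8 * f n ks (R ks)) ^ k * n ^ t
f-lower {d} n ks k t Πk≡1+k Σk≡t+d = result
  where
  open ≤-Reasoning
  X = n ^ t
  N = n ^ d

  instance
    2X≢0 : NonZero (2 * X)
    2X≢0 = m*n≢0 2 X {{_}} {{m^n≢0 n t}}

  -- With q^k at least 2X, the at most X * N edges account for no more than half of N * q^k, which
  -- leaves N ≤ 2qF.
  root = approximate-root k (2 * X)
  p = proj₁ root
  q = suc p
  2X≤q^k : 2 * X ≤ q ^ k
  2X≤q^k = proj₁ (proj₂ root)
  q^k≤ : q ^ k ≤ 2 ^ k * (2 * X)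
  q^k≤ = proj₂ (proj₂ root)

  es = boxes (cube d n) ks
  independent = uniform-independent p k es
    (subst (λ K → ListAll.All (λ e → ∣ e ∣ ≡ K) es) Πk≡1+k (boxes-size (cube d n) ks))
  S = proj₁ independent
  F = f n ks (R ks)

  ∣S∣≤F : ∣ S ∣ ≤ F
  ∣S∣≤F = independent⇒∣S∣≤f n ks S (proj₁ (proj₂ independent))

  edges : length es ≤ X * N
  edges = begin
    length es     ≤⟨ length-boxes n ks ⟩
    n ^ sum ks    ≡⟨ cong (n ^_) Σk≡t+d ⟩
    n ^ (t + d)   ≡⟨ ^-distribˡ-+-* n t d ⟩
    X * N         ∎

  N≤2qF : N ≤ 2 * q * F
  N≤2qF = *-cancelˡ-≤ (q ^ k) {{m^n≢0 q k}} (+-cancelʳ-≤ (q ^ k * N) _ _ (begin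
    q ^ k * N + q ^ k * N                      ≡⟨ double (q ^ k) N ⟩
    2 * (N * q ^ k)                            ≡⟨ cong (λ x → 2 * (x * q ^ k)) (product-cube d n) ⟨
    2 * (product (cube d n) * q ^ k)           ≤⟨ *-monoʳ-≤ 2 (proj₂ (proj₂ independent)) ⟩
    2 * (q * q ^ k * ∣ S ∣ + length es)        ≤⟨ *-monoʳ-≤ 2 (+-mono-≤ (*-monoʳ-≤ (q * q ^ k) ∣S∣≤F) edges) ⟩
    2 * (q * q ^ k * F + X * N)                ≡⟨ expand q (q ^ k) F X N ⟩
    q ^ k * (2 * q * F) + 2 * X * N            ≤⟨ +-monoʳ-≤ _ (*-monoˡ-≤ N 2X≤q^k) ⟩
    q ^ k * (2 * q * F) + q ^ k * N            ∎))
    where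
    double : ∀ Q N → Q * N + Q * N ≡ 2 * (N * Q)
    double = solve-∀
    expand : ∀ q Q F X N → 2 * (q * Q * F + X * N) ≡ Q * (2 * q * F) + 2 * X * N
    expand = solve-∀

  result : n ^ (d * k) ≤ (8 * F) ^ k * X
  result = begin
    n ^ (d * k)                              ≡⟨ ^-*-assoc n d k ⟨
    N ^ k                                    ≤⟨ ^-monoˡ-≤ k N≤2qF ⟩
    (2 * q * F) ^ k                          ≡⟨ ^-distribʳ-* k (2 * q) F ⟩
    (2 * q) ^ k * F ^ k                      ≡⟨ cong (_* F ^ k) (^-distribʳ-* k 2 q) ⟩
    2 ^ k * q ^ k * F ^ k                    ≤⟨ *-monoˡ-≤ (F ^ k) (*-monoʳ-≤ (2 ^ k) q^k≤) ⟩
    2 ^ k * (2 ^ k * (2 * X)) * F ^ k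
      -- The stray 2 from 2X is rounded up to 2^k, so that the three constants merge into 8^k.
      ≤⟨ *-monoˡ-≤ (F ^ k) (*-monoʳ-≤ (2 ^ k) (*-monoʳ-≤ (2 ^ k) (*-monoˡ-≤ X (^-monoʳ-≤ 2 (>-nonZero⁻¹ k))))) ⟩
    2 ^ k * (2 ^ k * (2 ^ k * X)) * F ^ k    ≡⟨ collect (2 ^ k) X (F ^ k) ⟩
    2 ^ k * (2 ^ k * 2 ^ k) * F ^ k * X      ≡⟨ cong (λ x → 2 ^ k * x * F ^ k * X) (^-distribʳ-* k 2 2) ⟨
    2 ^ k * 4 ^ k * F ^ k * X                ≡⟨ cong (λ x → x * F ^ k * X) (^-distribʳ-* k 2 4) ⟨
    8 ^ k * F ^ k * X                        ≡⟨ cong (_* X) (^-distribʳ-* k 8 F) ⟨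
    (8 * F) ^ k * X                          ∎
    where
    collect : ∀ a X G → a * (a * (a * X)) * G ≡ a * (a * a) * G * X
    collect = solve-∀

-- Arithmetic of the exponent d - β.

d≤sum : {ks : Vec ℕ d} → All (1 ≤_) ks → d ≤ sum ks
d≤sum []            = z≤n
d≤sum (1≤k ∷ 1≤ks) = +-mono-≤ 1≤k (d≤sum 1≤ks)

1≤product : {ks : Vec ℕ d} → All (1 ≤_) ks → 1 ≤ product ks
1≤product []            = ≤-refl
1≤product (1≤k ∷ 1≤ks) = *-mono-≤ 1≤k (1≤product 1≤ks)

-- Equivalently Σ(kᵢ − 1) ≤ Πkᵢ − 1, without truncated subtraction.
sum<product+d : {ks : Vec ℕ d} → All (1 ≤_) ks → suc (sum ks) ≤ product ks + d
sum<product+d []                                       = ≤-refl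
sum<product+d {suc d} {suc k ∷ ks} (_ ∷ 1≤ks) = begin
  suc (suc k + sum ks)                        ≡⟨ +-suc (suc k) (sum ks) ⟨
  suc k + suc (sum ks)                        ≤⟨ +-monoʳ-≤ (suc k) (sum<product+d 1≤ks) ⟩
  suc k + (product ks + d)                    ≡⟨ lhs k (product ks) d ⟩
  k * 1 + (product ks + suc d)                ≤⟨ +-monoˡ-≤ _ (*-monoʳ-≤ k (1≤product 1≤ks)) ⟩
  k * product ks + (product ks + suc d)       ≡⟨ rhs k (product ks) d ⟩
  suc k * product ks + suc d                  ∎
  where
  open ≤-Reasoning
  lhs : ∀ k P d → suc k + (P + d) ≡ k * 1 + (P + suc d)
  lhs = solve-∀
  rhs : ∀ k P d → k * P + (P + suc d) ≡ suc k * P + suc d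
  rhs = solve-∀

-- The exponent is an unreduced fraction with numerator dk - t = a. As this is a natural number, the
-- first clause of `_^[_]≤_` applies.
^[]≤-intro : ∀ {d s k t a} .{{_ : NonZero k}} → s ≡ t + d → a + t ≡ d * k →
  ∀ n y → n ^ a ≤ y ^ k → n ^[ (+ d) / 1 - ((+ s ℤ.- + d) / k) ]≤ y
^[]≤-intro {d} {_} {suc k} {t} {a} refl a+t≡dk n y n^a≤y^k =
  -- The common denominator `1 * suc k` computes to `suc (k + 0)`.
  subst (λ i → n ^[ i / suc (k + 0) ]≤ y) (sym numerator)
        (subst (λ j → n ^ a ≤ y ^ suc j) (sym (+-identityʳ k)) n^a≤y^k)
  where
  cancel : ∀ x y → + (x + y) ℤ.- + y ≡ + x
  cancel x y = trans (ℤ.+-assoc (+ x) (+ y) (ℤ.- + y))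
    (trans (cong (ℤ._+_ (+ x)) (ℤ.+-inverseʳ (+ y))) (ℤ.+-identityʳ (+ x)))
  open ≡-Reasoning
  numerator : + d ℤ.* + suc k ℤ.+ ℤ.- (+ (t + d) ℤ.- + d) ℤ.* + 1 ≡ + a
  numerator = begin
    + d ℤ.* + suc k ℤ.+ ℤ.- (+ (t + d) ℤ.- + d) ℤ.* + 1
      ≡⟨ cong₂ ℤ._+_ (sym (ℤ.pos-* d (suc k))) (ℤ.*-identityʳ (ℤ.- (+ (t + d) ℤ.- + d))) ⟩
    + (d * suc k) ℤ.- (+ (t + d) ℤ.- + d)  ≡⟨ cong₂ (λ x i → + x ℤ.- i) (sym a+t≡dk) (cancel t d) ⟩
    + (a + t) ℤ.- + t                      ≡⟨ cancel a t ⟩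
    + a                                    ∎

theorem2p1 : (d : ℕ) → 1 ≤ d → (ks : Vec ℕ d) → All (1 ≤_) ks →
    (1<Πk : 1 < product ks) →
    (λ n → f n ks (R ks)) ∈Ω[n^ (+ d) / 1 - β ks 1<Πk ]
-- The constant 8 is that of `f-lower`; the bound holds from n = 1 on, where n^t is nonzero and can
-- be cancelled.
theorem2p1 d 1≤d ks 1≤ks 1<Πk = 8 , s≤s z≤n , 1 , λ n 1≤n →
  ^[]≤-intro {{k≢0}} Σk≡t+d a+t≡dk n _ (bound n {{>-nonZero 1≤n}})
  where
  k = product ks ∸ 1
  t = sum ks ∸ d
  a = d * k ∸ t
  instance
    k≢0 : NonZero k
    k≢0 = >-nonZero (m<n⇒0<n∸m 1<Πk)
  Πk≡1+k : product ks ≡ suc k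
  Πk≡1+k = sym (m+[n∸m]≡n (<⇒≤ 1<Πk))
  Σk≡t+d : sum ks ≡ t + d
  Σk≡t+d = sym (m∸n+n≡m (d≤sum 1≤ks))
  -- This is β ≤ 1; together with 1 ≤ d it makes the truncated difference `a` exact.
  t≤k : t ≤ k
  t≤k = +-cancelʳ-≤ d t k (subst (_≤ k + d) Σk≡t+d
    (s≤s⁻¹ (subst (λ x → suc (sum ks) ≤ x + d) Πk≡1+k (sum<product+d 1≤ks))))
  a+t≡dk : a + t ≡ d * k
  a+t≡dk = m∸n+n≡m (≤-trans t≤k (m≤n*m k d {{>-nonZero 1≤d}}))
  bound : ∀ n .{{_ : NonZero n}} → n ^ a ≤ (8 * f n ks (R ks)) ^ k
  bound n = *-cancelʳ-≤ _ _ (n ^ t) {{m^n≢0 n t}} (begin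
    n ^ a * n ^ t                      ≡⟨ ^-distribˡ-+-* n a t ⟨
    n ^ (a + t)                        ≡⟨ cong (n ^_) a+t≡dk ⟩
    n ^ (d * k)                        ≤⟨ f-lower n ks k t Πk≡1+k Σk≡t+d ⟩
    (8 * f n ks (R ks)) ^ k * n ^ t    ∎)
    where open ≤-Reasoning
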